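{- Let $G$ be a connected graph of order $n$ and let $k$ be an integer with $2\leq k\leq n$. Then $$k-1\leq \lambda_k(G)\leq \binom{n}{2}-\binom{n-k+1}{2}.$$ Moreover, the lower bound is attained (i.e. $\lambda_k(G)=k-1$) if and only if $G$ contains at least $k-1$ cut edges, and the upper bound is attained (i.e. $\lambda_k(G)=\binom{n}{2}-\binom{n-k+1}{2}$) if and only if $G\cong K_n$.
   Context: Graphs are finite, simple and undirected. For a graph $G$ of order $n$ (number of vertices) and an integer $k$ with $2\leq k\leq n$, the $k$-edge-connectivity $\lambda_k(G)$ is the smallest number of edges whose removal from $G$ produces a graph with at least $k$ connected components. A cut edge (bridge) is an edge whose removal increases the number of connected components. $K_n$ is the complete graph of order $n$. The convention $\binom{1}{2}=0$ is used. -}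

module Defs where

open import Level using (0ℓ)
open import Data.Nat.Base using (ℕ; zero; suc; _≤_; _<_; z≤n; s≤s)
import Data.Nat.Properties as ℕₚ
open import Data.Fin.Base as Fin using (Fin; punchIn; punchOut)
open import Data.Fin.Properties as Finₚ
  using (_≟_; punchInᵢ≢i; punchOut-punchIn; punchOut-cong; punchOut-injective)
open import Data.Fin.Permutation using (Permutation; _⟨$⟩ʳ_)
open import Data.List.Base using (List; []; _∷_; [_]; length; filter; allFin; cartesianProduct)
open import Data.List.Membership.Propositional using (_∈_; _∉_)
open import Data.List.Membership.Propositional.Properties
  using (∈-filter⁺; ∈-filter⁻; ∈-cartesianProduct⁺; ∈-allFin)
open import Data.List.Membership.DecPropositional using (_∉?_)
open import Data.List.Relation.Binary.Sublist.Propositional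
  using (_⊆_; []; _∷ʳ_; _∷_; ⊆-refl)
open import Data.List.Relation.Unary.All as All using (All; []; _∷_)
open import Data.Product.Base using (Σ; ∃; _×_; _,_; proj₁; proj₂; uncurry)
open import Data.Product.Properties using (≡-dec)
open import Data.Empty using (⊥-elim)
open import Function.Base using (_∘_; id)
open import Function.Bundles using (Bijection; _⇔_)
open import Relation.Binary.Bundles using (Setoid)
open import Relation.Binary.Core using (Rel)
open import Relation.Binary.Definitions
  using (Decidable; DecidableEquality; Symmetric; Irreflexive; tri<; tri≈; tri>)
open import Relation.Binary.Structures using (IsEquivalence)
open import Relation.Binary.Construct.Closure.ReflexiveTransitive
  using (Star; ε; _◅_; _◅◅_; reverse; return)
open import Relation.Binary.PropositionalEquality
  using (_≡_; _≢_; refl; sym; trans; cong; setoid)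
open import Relation.Nullary using (Dec; yes; no)
open import Relation.Nullary.Decidable using (_×-dec_; ¬?)
import Relation.Unary as U

record Graph (n : ℕ) : Set₁ where
  field
    Adj    : Rel (Fin n) 0ℓ
    adj?   : Decidable Adj
    symm   : Symmetric Adj
    irrefl : Irreflexive _≡_ Adj

open Graph public

Pair : ℕ → Set
Pair n = Fin n × Fin n

_≟ₚ_ : ∀ {n} → DecidableEquality (Pair n)
_≟ₚ_ = ≡-dec _≟_ _≟_

isEdge? : ∀ {n} (G : Graph n) →
          U.Decidable {A = Pair n} (λ (u , v) → u Fin.< v × Adj G u v)
isEdge? G (u , v) = (u Finₚ.<? v) ×-dec adj? G u v

-- Each undirected edge is listed exactly once, smaller endpoint first.
edges : ∀ {n} → Graph n → List (Pair n)
edges {n} G = filter (isEdge? G) (cartesianProduct (allFin n) (allFin n))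

infixl 6 _─_

_─_ : ∀ {n} → Graph n → List (Pair n) → Graph n
(G ─ F) .Adj u v = Adj G u v × (u , v) ∉ F × (v , u) ∉ F
(G ─ F) .adj? u v =
  adj? G u v ×-dec (_∉?_ _≟ₚ_ (u , v) F ×-dec _∉?_ _≟ₚ_ (v , u) F)
(G ─ F) .symm (uv , p , q) = symm G uv , q , p
(G ─ F) .irrefl u≡v (uv , _) = irrefl G u≡v uv

K : (n : ℕ) → Graph n
K n .Adj  = _≢_
K n .adj? u v = ¬? (u ≟ v)
K n .symm u≢v = u≢v ∘ sym
K n .irrefl u≡v u≢v = u≢v u≡v

infix 4 _≅_

_≅_ : ∀ {m n} → Graph m → Graph n → Set
_≅_ {m} {n} G H = Σ (Permutation m n) λ π →
  ∀ u v → Adj G u v ⇔ Adj H (π ⟨$⟩ʳ u) (π ⟨$⟩ʳ v)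

Reachable : ∀ {n} → Graph n → Rel (Fin n) 0ℓ
Reachable G = Star (Adj G)

Connected : ∀ {n} → Graph n → Set
Connected G = ∀ u v → Reachable G u v

-- The set of connected components: vertices modulo reachability.
Components : ∀ {n} → Graph n → Setoid 0ℓ 0ℓ
Components {n} G = record
  { Carrier       = Fin n
  ; _≈_           = Reachable G
  ; isEquivalence = record
    { refl  = ε
    ; sym   = reverse (symm G)
    ; trans = _◅◅_
    }
  }

∈-edges : ∀ {n} (G : Graph n) {u v} → u Fin.< v → Adj G u v → (u , v) ∈ edges G
∈-edges G u<v uv =
  ∈-filter⁺ (isEdge? G) (∈-cartesianProduct⁺ (∈-allFin _) (∈-allFin _)) (u<v , uv)

edges-adj : ∀ {n} (G : Graph n) → All (uncurry (Adj G)) (edges G)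
edges-adj G = All.tabulate
  (proj₂ ∘ proj₂ ∘ ∈-filter⁻ (isEdge? G) {xs = cartesianProduct (allFin _) (allFin _)})

module _ {m} (i j : Fin (suc m)) (i≢j : i ≢ j) where
  merge : Fin (suc m) → Fin m
  merge x with i ≟ x
  ... | yes _   = punchOut i≢j
  ... | no  i≢x = punchOut i≢x

  merge-ij : merge i ≡ merge j
  merge-ij with i ≟ i | i ≟ j
  ... | no i≢i | _       = ⊥-elim (i≢i refl)
  ... | yes _  | yes i≡j = ⊥-elim (i≢j i≡j)
  ... | yes _  | no _    = punchOut-cong i refl

  merge-punchIn : ∀ y → merge (punchIn i y) ≡ y
  merge-punchIn y with i ≟ punchIn i y
  ... | yes e = ⊥-elim (punchInᵢ≢i i y (sym e))
  ... | no  _ = trans (punchOut-cong i refl) (punchOut-punchIn i)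

  data Merged (x y : Fin (suc m)) : Set where
    same : x ≡ y → Merged x y
    ij   : i ≡ x → j ≡ y → Merged x y
    ji   : j ≡ x → i ≡ y → Merged x y

  merge-injective : ∀ x y → merge x ≡ merge y → Merged x y
  merge-injective x y e with i ≟ x | i ≟ y
  ... | yes p | yes q = same (trans (sym p) q)
  ... | yes p | no  q = ij p (punchOut-injective i≢j q e)
  ... | no  p | yes q = ji (sym (punchOut-injective p i≢j e)) q
  ... | no  p | no  q = same (punchOut-injective p q e)

module _ {n} (_≈_ : Rel (Fin n) 0ℓ) (≈-equiv : IsEquivalence _≈_) where
  private module E = IsEquivalence ≈-equiv

  record Labelling (es : List (Pair n)) : Set where
    field
      #labels  : ℕ
      label    : Fin n → Fin #labels
      onto     : ∀ y → ∃ λ u → label u ≡ y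
      sound    : ∀ {u v} → label u ≡ label v → u ≈ v
      complete : All (λ (u , v) → label u ≡ label v) es

  -- Start from n distinct labels and merge two of them along each pair in turn.
  labelling : ∀ {es} → All (uncurry _≈_) es → Labelling es
  labelling [] = record
    { #labels = n ; label = id ; onto = λ y → y , refl
    ; sound = λ { refl → E.refl } ; complete = [] }
  labelling {(a , b) ∷ _} (a≈b ∷ es≈) with labelling es≈
  ... | record { #labels = zero ; label = c } with () ← c a
  ... | record { #labels = suc m ; label = c ; onto = onto
               ; sound = sound ; complete = complete }
    with c a ≟ c b
  ... | yes ca≡cb = record
    { #labels = suc m ; label = c ; onto = onto ; sound = sound
    ; complete = ca≡cb ∷ complete }
  ... | no ca≢cb = record
    { #labels  = m
    ; label    = f ∘ c
    ; onto     = λ y → let (u , cu≡) = onto (punchIn (c a) y) in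
                 u , trans (cong f cu≡) (merge-punchIn (c a) (c b) ca≢cb y)
    ; sound    = λ {u} {v} e → sound′ (merge-injective (c a) (c b) ca≢cb (c u) (c v) e)
    ; complete = merge-ij (c a) (c b) ca≢cb ∷ All.map (cong f) complete
    }
    where
    f = merge (c a) (c b) ca≢cb
    sound′ : ∀ {u v} → Merged (c a) (c b) ca≢cb (c u) (c v) → u ≈ v
    sound′ (same e)  = sound e
    sound′ (ij p q) = E.trans (sound (sym p)) (E.trans a≈b (sound q))
    sound′ (ji p q) = E.trans (sound (sym p)) (E.trans (E.sym a≈b) (sound q))

components-finite : ∀ {n} (G : Graph n) →
                    ∃ λ m → Bijection (Components G) (setoid (Fin m))
components-finite {n} G = #labels , record
  { to        = label
  ; cong      = reach
  ; bijective = sound , λ y → let (u , lu≡y) = onto y in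
                u , λ z~u → trans (reach z~u) lu≡y
  }
  where
  open Labelling (labelling (Reachable G) (Setoid.isEquivalence (Components G))
                            (All.map return (edges-adj G)))
  step : ∀ {u v} → Adj G u v → label u ≡ label v
  step {u} {v} uv with Finₚ.<-cmp u v
  ... | tri< u<v _ _ = All.lookup complete (∈-edges G u<v uv)
  ... | tri≈ _ u≡v _ = cong label u≡v
  ... | tri> _ _ v<u = sym (All.lookup complete (∈-edges G v<u (symm G uv)))
  reach : ∀ {u v} → Reachable G u v → label u ≡ label v
  reach ε        = refl
  reach (e ◅ es) = trans (step e) (reach es)

#components : ∀ {n} → Graph n → ℕ
#components G = proj₁ (components-finite G)

IsCutEdge : ∀ {n} → Graph n → Pair n → Set
IsCutEdge G e = #components G < #components (G ─ [ e ])

isCutEdge? : ∀ {n} (G : Graph n) → U.Decidable (IsCutEdge G)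
isCutEdge? G e = #components G ℕₚ.<? #components (G ─ [ e ])

#cutEdges : ∀ {n} → Graph n → ℕ
#cutEdges G = length (filter (isCutEdge? G) (edges G))

-- Removing some l edges of G leaves at least k components.  The sublists of
-- the duplicate-free list  edges G  are exactly the sets of edges of G.
Separates : ∀ {n} → Graph n → ℕ → ℕ → Set
Separates G k l =
  ∃ λ F → F ⊆ edges G × length F ≡ l × k ≤ #components (G ─ F)

IsLeast : (ℕ → Set) → ℕ → Set
IsLeast P m = P m × (∀ {l} → P l → m ≤ l)

anySublist? : ∀ {A : Set} {P : List A → Set} → U.Decidable P →
              ∀ xs → Dec (∃ λ ys → ys ⊆ xs × P ys)
anySublist? P? [] with P? []
... | yes p = yes ([] , [] , p)
... | no ¬p = no λ { (.[] , [] , p) → ¬p p }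
anySublist? P? (x ∷ xs) with anySublist? P? xs
... | yes (ys , s , p) = yes (ys , x ∷ʳ s , p)
... | no ¬skip with anySublist? (P? ∘ (x ∷_)) xs
...   | yes (ys , s , p) = yes (x ∷ ys , refl ∷ s , p)
...   | no ¬keep = no λ
  { (ys     , .x ∷ʳ s   , p) → ¬skip (ys , s , p)
  ; (_ ∷ ys , refl ∷ s , p) → ¬keep (ys , s , p)
  }

separates? : ∀ {n} (G : Graph n) k → U.Decidable (Separates G k)
separates? G k l = anySublist?
  (λ F → (length F ℕₚ.≟ l) ×-dec (k ℕₚ.≤? #components (G ─ F))) (edges G)

least : ∀ {P : ℕ → Set} → U.Decidable P → ∀ l → P l → ∃ (IsLeast P)
least P? zero p = zero , p , λ _ → z≤n
least {P} P? (suc l) p with P? zero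
... | yes p₀ = zero , p₀ , λ _ → z≤n
... | no ¬p₀ with least {P ∘ suc} (P? ∘ suc) l p
...   | m , pm , min = suc m , pm , λ
  { {zero} p₀ → ⊥-elim (¬p₀ p₀) ; {suc _} q → s≤s (min q) }

no-edges : ∀ {n} (G : Graph n) {u v} → Reachable (G ─ edges G) u v → u ≡ v
no-edges G ε = refl
no-edges G {u} (_◅_ {j = v} (uv , uv∉ , vu∉) _) with Finₚ.<-cmp u v
... | tri< u<v _ _ = ⊥-elim (uv∉ (∈-edges G u<v uv))
... | tri≈ _ u≡v _ = ⊥-elim (irrefl G u≡v uv)
... | tri> _ _ v<u = ⊥-elim (vu∉ (∈-edges G v<u (symm G uv)))

separates-all : ∀ {n} (G : Graph n) k → k ≤ n → Separates G k (length (edges G))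
separates-all G k k≤n = edges G , ⊆-refl , refl ,
  ℕₚ.≤-trans k≤n (Finₚ.injective⇒≤ {f = to} (no-edges G ∘ injective))
  where open Bijection (proj₂ (components-finite (G ─ edges G)))

edgeConnectivity-exists : ∀ {n} (G : Graph n) k → k ≤ n →
                          ∃ (IsLeast (Separates G k))
edgeConnectivity-exists G k k≤n =
  least (separates? G k) (length (edges G)) (separates-all G k k≤n)

edgeConnectivity : ∀ {n} (G : Graph n) k → k ≤ n → ℕ
edgeConnectivity G k k≤n = proj₁ (edgeConnectivity-exists G k k≤n)

{-# OPTIONS --safe #-}
module Submission where

-- Deleting one edge splits at most one component in two, and deleting a cut edge
-- of G always splits one, even after other edges are gone; this gives the lower
-- bound and its equality case.  For the upper bound, view a partition into k
-- classes as a labelling c by Fin k: separating the classes costs at most the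
-- number of pairs u < v with c u ≢ c v, i.e. n C 2 minus the pairs inside classes.
-- Pairs inside classes number at most (n ∸ k + 1) C 2, with equality for one class
-- of n ∸ k + 1 vertices and singletons otherwise; this computes λₖ(Kₙ).  If u ≢ v
-- are not adjacent, such a partition separating u from v costs strictly less.

open import Defs
open import Data.Fin.Base as Fin using (Fin; zero; suc; punchIn; punchOut)
open import Data.Fin.Permutation using () renaming (id to idₚ)
open import Data.Fin.Properties as Finₚ using (_≟_; any?; injective⇒≤)
open import Data.List.Base
  using (List; []; _∷_; [_]; _++_; length; map; filter; take; removeAt;
         tabulate; allFin; cartesianProduct)
open import Data.List.Membership.DecPropositional using (_∈?_)
open import Data.List.Membership.Propositional using (_∈_; _∉_)
open import Data.List.Membership.Propositional.Properties
  using (∈-filter⁺; ∈-filter⁻; ∈-cartesianProduct⁺; ∈-allFin)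
open import Data.List.Properties
  using (length-removeAt′; length-take; length-++; length-tabulate; map-tabulate;
         filter-++; filter-≐; filter-none; filter-accept; filter-reject; filter-all)
open import Data.List.Relation.Binary.Sublist.Propositional
  using (_⊆_; ⊆-refl; ⊆-trans)
import Data.List.Relation.Binary.Sublist.Propositional.Properties as Sublistₚ
open import Data.List.Relation.Binary.Sublist.Heterogeneous.Properties using (toPointwise)
open import Data.List.Relation.Binary.Pointwise using (Pointwise-≡⇒≡)
open import Data.List.Relation.Unary.All as All using (All; []; _∷_)
import Data.List.Relation.Unary.All.Properties as Allₚ
open import Data.List.Relation.Unary.Any as Any using (here; there)
open import Data.List.Relation.Unary.AllPairs using ([]; _∷_)
open import Data.List.Relation.Unary.Unique.Propositional using (Unique)
import Data.List.Relation.Unary.Unique.Propositional.Properties as Uniqueₚ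
open import Data.Nat using (ℕ; zero; suc; _≤_; _<_; _+_; _∸_; z≤n; s≤s)
open import Data.Nat.Combinatorics using (_C_; nC1≡n; nCk+nC[k+1]≡[n+1]C[k+1])
import Data.Nat.Properties as ℕₚ
open import Data.Product using (Σ; ∃; _×_; _,_; proj₁; proj₂)
open import Data.Sum using (_⊎_; inj₁; inj₂)
open import Function.Base using (_∘_; id)
open import Function.Bundles using (_⇔_; mk⇔; Bijection; Equivalence; Injection)
open import Function.Properties.Inverse using (↔⇒↣)
open import Level using (0ℓ)
open import Relation.Binary.Construct.Closure.ReflexiveTransitive as Star
  using (ε; _◅_; _◅◅_; _⋆; return)
open import Relation.Binary.Core using (Rel)
open import Relation.Binary.Definitions using (Decidable; Tri; tri<; tri≈; tri>)
open import Relation.Binary.PropositionalEquality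
  using (_≡_; _≢_; refl; sym; trans; cong; cong₂; subst; module ≡-Reasoning)
open import Relation.Nullary using (¬_; Dec; yes; no; contradiction)
open import Relation.Nullary.Decidable using (_×-dec_; ¬?; decidable-stable)
import Relation.Unary as U

private variable
  n m k q : ℕ

Onto : (Fin n → Fin m) → Set
Onto f = ∀ y → ∃ λ u → f u ≡ y

-- Lists

∈-removeAt : ∀ {A : Set} {x y : A} {xs} (x∈xs : x ∈ xs) → y ∈ xs →
             y ≡ x ⊎ y ∈ removeAt xs (Any.index x∈xs)
∈-removeAt (here refl) (here eq) = inj₁ eq
∈-removeAt (here refl) (there i) = inj₂ i
∈-removeAt (there p)   (here eq) = inj₂ (here eq)
∈-removeAt (there p)   (there i) with ∈-removeAt p i
... | inj₁ eq = inj₁ eq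
... | inj₂ j  = inj₂ (there j)

module _ {A : Set} {P : A → Set} (P? : U.Decidable P) where

  length-filter-map : ∀ {B : Set} (f : B → A) xs →
                      length (filter P? (map f xs)) ≡ length (filter (P? ∘ f) xs)
  length-filter-map f []       = refl
  length-filter-map f (x ∷ xs) with P? (f x)
  ... | yes _ = cong suc (length-filter-map f xs)
  ... | no _  = length-filter-map f xs

  length-filter-++ : ∀ xs ys → length (filter P? (xs ++ ys)) ≡
                               length (filter P? xs) + length (filter P? ys)
  length-filter-++ xs ys = trans (cong length (filter-++ P? xs ys)) (length-++ (filter P? xs))

  length-filter-¬ : ∀ xs → length (filter P? xs) + length (filter (¬? ∘ P?) xs) ≡ length xs
  length-filter-¬ []       = refl
  length-filter-¬ (x ∷ xs) with P? x
  ... | yes _ = cong suc (length-filter-¬ xs)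
  ... | no _  = trans (ℕₚ.+-suc _ _) (cong suc (length-filter-¬ xs))

-- Each head of `xs` is charged to one occurrence in `ys`, which is then deleted; uniqueness keeps
-- the later elements off the deleted occurrence.
unique-⊆⇒length≤ : ∀ {A : Set} {xs ys : List A} → Unique xs →
                   (∀ {x} → x ∈ xs → x ∈ ys) → length xs ≤ length ys
unique-⊆⇒length≤ [] sub = z≤n
unique-⊆⇒length≤ {xs = x ∷ xs} {ys} (x∉xs ∷ uniq) sub =
  subst (suc (length xs) ≤_) (sym (length-removeAt′ ys (Any.index x∈ys)))
    (s≤s (unique-⊆⇒length≤ uniq sub′))
  where
  x∈ys = sub (here refl)
  sub′ : ∀ {y} → y ∈ xs → y ∈ removeAt ys (Any.index x∈ys)
  sub′ y∈xs with ∈-removeAt x∈ys (sub (there y∈xs))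
  ... | inj₁ refl = contradiction y∈xs (Allₚ.All¬⇒¬Any x∉xs)
  ... | inj₂ i    = i

-- Components

module _ (G : Graph n) where
  private module B = Bijection (proj₂ (components-finite G))

  component : Fin n → Fin (#components G)
  component = B.to

  component-cong : ∀ {u v} → Reachable G u v → component u ≡ component v
  component-cong = B.cong

  component-injective : ∀ {u v} → component u ≡ component v → Reachable G u v
  component-injective = B.injective

  component-onto : Onto component
  component-onto y = let (u , eq) = B.surjective y in u , eq ε

  reachable⇒≡ : {f : Fin n → Fin m} → (∀ {u v} → Adj G u v → f u ≡ f v) →
                ∀ {u v} → Reachable G u v → f u ≡ f v
  reachable⇒≡ step ε        = refl
  reachable⇒≡ step (e ◅ es) = trans (step e) (reachable⇒≡ step es)

  -- A map constant along edges is constant on components, so chosen preimages of distinct labels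
  -- lie in distinct components.
  onto⇒≤#components : (f : Fin n → Fin m) → Onto f →
                      (∀ {u v} → Adj G u v → f u ≡ f v) → m ≤ #components G
  onto⇒≤#components f onto step = injective⇒≤ {f = component ∘ proj₁ ∘ onto} λ {y} {z} eq →
    trans (sym (proj₂ (onto y)))
          (trans (reachable⇒≡ step (component-injective eq)) (proj₂ (onto z)))

  sound⇒#components≤ : (f : Fin n → Fin m) →
                       (∀ {u v} → f u ≡ f v → Reachable G u v) → #components G ≤ m
  sound⇒#components≤ f sound =
    injective⇒≤ {f = f ∘ proj₁ ∘ component-onto} λ {y} {z} eq →
      trans (sym (proj₂ (component-onto y)))
            (trans (component-cong (sound eq)) (proj₂ (component-onto z)))

  -- The map may change only across the pair `(a , b)`. Merging `f a` and `f b` makes it constant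
  -- along all edges at the price of one label; this is the step for deleting a single edge.
  onto⇒≤1+#components : ∀ {a b} (f : Fin n → Fin m) → Onto f →
    (∀ {u v} → Adj G u v → f u ≡ f v ⊎ (u , v) ≡ (a , b) ⊎ (v , u) ≡ (a , b)) →
    m ≤ suc (#components G)
  onto⇒≤1+#components {m = zero}  f onto step = z≤n
  onto⇒≤1+#components {m = suc m} {a} {b} f onto step with f a ≟ f b
  ... | yes fa≡fb = ℕₚ.m≤n⇒m≤1+n (onto⇒≤#components f onto (step′ ∘ step))
    where
    step′ : ∀ {u v} → f u ≡ f v ⊎ (u , v) ≡ (a , b) ⊎ (v , u) ≡ (a , b) → f u ≡ f v
    step′ (inj₁ eq)          = eq
    step′ (inj₂ (inj₁ refl)) = fa≡fb
    step′ (inj₂ (inj₂ refl)) = sym fa≡fb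
  ... | no fa≢fb = s≤s (onto⇒≤#components (g ∘ f) onto′ (step′ ∘ step))
    where
    g = merge (f a) (f b) fa≢fb
    onto′ : Onto (g ∘ f)
    onto′ y = let (u , eq) = onto (punchIn (f a) y) in
      u , trans (cong g eq) (merge-punchIn (f a) (f b) fa≢fb y)
    step′ : ∀ {u v} → f u ≡ f v ⊎ (u , v) ≡ (a , b) ⊎ (v , u) ≡ (a , b) → g (f u) ≡ g (f v)
    step′ (inj₁ eq)          = cong g eq
    step′ (inj₂ (inj₁ refl)) = merge-ij (f a) (f b) fa≢fb
    step′ (inj₂ (inj₂ refl)) = sym (merge-ij (f a) (f b) fa≢fb)

  -- Merging the labels `f a` and `f b` stays sound because `a` reaches `b`, which saves one of the
  -- `m` labels.
  sound⇒#components< : ∀ {a b} (f : Fin n → Fin m) →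
    (∀ {u v} → f u ≡ f v → Reachable G u v) →
    f a ≢ f b → Reachable G a b → #components G < m
  sound⇒#components< {m = zero}  {a} f sound fa≢fb a~b with () ← f a
  sound⇒#components< {m = suc m} {a} {b} f sound fa≢fb a~b =
    s≤s (sound⇒#components≤ (merge (f a) (f b) fa≢fb ∘ f)
      (λ {u} {v} eq → sound′ (merge-injective (f a) (f b) fa≢fb (f u) (f v) eq)))
    where
    sound′ : ∀ {u v} → Merged (f a) (f b) fa≢fb (f u) (f v) → Reachable G u v
    sound′ (same eq) = sound eq
    sound′ (ij p q)  = sound (sym p) ◅◅ a~b ◅◅ sound q
    sound′ (ji p q)  = sound (sym p) ◅◅ Star.reverse (symm G) a~b ◅◅ sound q

-- Removing edges

#components-anti : (G H : Graph n) → (∀ {u v} → Adj H u v → Adj G u v) →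
                   #components G ≤ #components H
#components-anti G H H⊆G =
  sound⇒#components≤ G (component H) (Star.map H⊆G ∘ component-injective H)

-- The components left after deleting `e` label the vertices of `G ─ F`; along the edges of `G ─ F`
-- this label can change only at `e`.
#components-∷ : ∀ (G : Graph n) e F → #components (G ─ (e ∷ F)) ≤ suc (#components (G ─ F))
#components-∷ G (a , b) F =
  onto⇒≤1+#components (G ─ F) (component H) (component-onto H) step
  where
  H = G ─ ((a , b) ∷ F)
  step : ∀ {u v} → Adj (G ─ F) u v →
         component H u ≡ component H v ⊎ (u , v) ≡ (a , b) ⊎ (v , u) ≡ (a , b)
  step {u} {v} (uv , uv∉ , vu∉) with (u , v) ≟ₚ (a , b) | (v , u) ≟ₚ (a , b)
  ... | yes p | _     = inj₂ (inj₁ p)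
  ... | no _  | yes p = inj₂ (inj₂ p)
  ... | no p  | no p′ = inj₁ (component-cong H (return (uv ,
    (λ { (here eq) → p eq ; (there i) → uv∉ i }) ,
    (λ { (here eq) → p′ eq ; (there i) → vu∉ i }))))

#components-─ : ∀ (G : Graph n) F → #components (G ─ F) ≤ length F + #components G
#components-─ G []      = #components-anti (G ─ []) G λ uv → uv , (λ ()) , (λ ())
#components-─ G (e ∷ F) = ℕₚ.≤-trans (#components-∷ G e F) (s≤s (#components-─ G F))

-- Delete `e` first; each of the other `length F ∸ 1` edges then adds at most one component. For a
-- tight `F` this will force every edge of `F` to be a cut edge.
#components-─-∈ : ∀ (G : Graph n) {e F} → e ∈ F →
                  suc (#components (G ─ F)) ≤ length F + #components (G ─ [ e ])
#components-─-∈ G {e} {F} e∈F = begin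
  suc (#components (G ─ F))                ≤⟨ s≤s (#components-anti (G ─ F) (G ─ [ e ] ─ F′) sub) ⟩
  suc (#components (G ─ [ e ] ─ F′))       ≤⟨ s≤s (#components-─ (G ─ [ e ]) F′) ⟩
  suc (length F′) + #components (G ─ [ e ])
    ≡⟨ cong (_+ #components (G ─ [ e ])) (length-removeAt′ F (Any.index e∈F)) ⟨
  length F + #components (G ─ [ e ])       ∎
  where
  open ℕₚ.≤-Reasoning
  F′ = removeAt F (Any.index e∈F)
  sub : ∀ {u v} → Adj (G ─ [ e ] ─ F′) u v → Adj (G ─ F) u v
  sub ((uv , ≢e , ≢e′) , uv∉ , vu∉) = uv , avoid ≢e uv∉ , avoid ≢e′ vu∉
    where
    avoid : ∀ {p} → p ∉ [ e ] → p ∉ F′ → p ∉ F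
    avoid p∉e p∉F′ p∈F with ∈-removeAt e∈F p∈F
    ... | inj₁ eq = p∉e (here eq)
    ... | inj₂ i  = p∉F′ i

-- If `a` still reached `b`, every use of the edge could be rerouted, and the deletion would add no
-- component.
cutEdge-disconnects : ∀ (G : Graph n) {a b} → IsCutEdge G (a , b) → ¬ Reachable (G ─ [ a , b ]) a b
cutEdge-disconnects G {a} {b} cut a~b = ℕₚ.<⇒≱ cut
  (sound⇒#components≤ H (component G) ((step ⋆) ∘ component-injective G))
  where
  H = G ─ [ a , b ]
  step : ∀ {u v} → Adj G u v → Reachable H u v
  step {u} {v} uv with (u , v) ≟ₚ (a , b) | (v , u) ≟ₚ (a , b)
  ... | yes refl | _        = a~b
  ... | no _     | yes refl = Star.reverse (symm H) a~b
  ... | no p     | no p′    = return (uv , (λ { (here eq) → p eq }) , (λ { (here eq) → p′ eq }))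

-- Delete the head of the list last. Its endpoints are adjacent in `G ─ F`, but afterwards they are
-- disconnected, since deleting the cut edge alone already separates them; so each deletion gains a
-- component.
#components-─-cutEdges : ∀ (G : Graph n) {F} → Unique F →
  All (λ (u , v) → u Fin.< v × Adj G u v) F → All (IsCutEdge G) F →
  length F + #components G ≤ #components (G ─ F)
#components-─-cutEdges G [] [] [] = #components-anti G (G ─ []) proj₁
#components-─-cutEdges G {(a , b) ∷ F} (ab∉F ∷ uniq) ((a<b , ab) ∷ es) (cut ∷ cuts) =
  ℕₚ.≤-trans (s≤s (#components-─-cutEdges G uniq es cuts))
    (sound⇒#components< (G ─ F) (component H)
      (Star.map weaken ∘ component-injective H)
      (cutEdge-disconnects G cut ∘ Star.map toSingle ∘ component-injective H)
      -- The edge is still present in `G ─ F`: uniqueness excludes `(a , b)` from `F`, and the pairs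
      -- of `F` being increasing excludes `(b , a)`.
      (return (ab , Allₚ.All¬⇒¬Any ab∉F , λ ba∈F → ℕₚ.<-asym a<b (proj₁ (All.lookup es ba∈F)))))
  where
  H = G ─ ((a , b) ∷ F)
  weaken : ∀ {u v} → Adj H u v → Adj (G ─ F) u v
  weaken (uv , p , p′) = uv , p ∘ there , p′ ∘ there
  toSingle : ∀ {u v} → Adj H u v → Adj (G ─ [ a , b ]) u v
  toSingle (uv , p , p′) = uv , (λ { (here eq) → p (here eq) }) , (λ { (here eq) → p′ (here eq) })

connected⇒#components≤1 : (G : Graph n) → Connected G → #components G ≤ 1
connected⇒#components≤1 G conn = sound⇒#components≤ G (λ _ → zero) (λ _ → conn _ _)

-- Counting pairs

count : {P : Fin n → Set} → U.Decidable P → ℕ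
count P? = length (filter P? (allFin _))

allFin-suc : ∀ n → allFin (suc n) ≡ zero ∷ map suc (allFin n)
allFin-suc n = cong (zero ∷_) (sym (map-tabulate id suc))

module _ {P : Fin n → Set} (P? : U.Decidable P) {Q : Fin n → Set} (Q? : U.Decidable Q) where
  count-mono : (∀ {v} → P v → Q v) → count P? ≤ count Q?
  count-mono P⊆Q = Sublistₚ.length-mono-≤
    (Sublistₚ.filter⁺ P? Q? (λ { refl → P⊆Q }) (⊆-refl {x = allFin n}))

module _ {P : Fin (suc n) → Set} (P? : U.Decidable P) where

  count-tail : length (filter P? (tabulate suc)) ≡ count (P? ∘ suc)
  count-tail = trans (cong (length ∘ filter P?) (sym (map-tabulate id suc)))
                     (length-filter-map P? suc (allFin n))

  count-accept : P zero → count P? ≡ suc (count (P? ∘ suc))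
  count-accept p = trans (cong length (filter-accept P? p)) (cong suc count-tail)

  count-reject : ¬ P zero → count P? ≡ count (P? ∘ suc)
  count-reject ¬p = trans (cong length (filter-reject P? ¬p)) count-tail

pair? : {R : Rel (Fin n) 0ℓ} → Decidable R → U.Decidable {A = Pair n} (λ (u , v) → u Fin.< v × R u v)
pair? R? (u , v) = (u Finₚ.<? v) ×-dec R? u v

-- `edges G` unfolds to `pairs (adj? G)`, so the results on `pairs` apply to edge lists as they
-- stand.
pairs : {R : Rel (Fin n) 0ℓ} → Decidable R → List (Pair n)
pairs {n} R? = filter (pair? R?) (cartesianProduct (allFin n) (allFin n))

module _ {R : Rel (Fin n) 0ℓ} (R? : Decidable R) where

  ∈-pairs⁺ : ∀ {u v} → u Fin.< v → R u v → (u , v) ∈ pairs R?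
  ∈-pairs⁺ u<v uv = ∈-filter⁺ (pair? R?) (∈-cartesianProduct⁺ (∈-allFin _) (∈-allFin _)) (u<v , uv)

  ∈-pairs⁻ : ∀ {p} → p ∈ pairs R? → proj₁ p Fin.< proj₂ p × R (proj₁ p) (proj₂ p)
  ∈-pairs⁻ = proj₂ ∘ ∈-filter⁻ (pair? R?) {xs = cartesianProduct (allFin n) (allFin n)}

  pairs-unique : Unique (pairs R?)
  pairs-unique = Uniqueₚ.filter⁺ (pair? R?)
    (Uniqueₚ.cartesianProduct⁺ (Uniqueₚ.allFin⁺ n) (Uniqueₚ.allFin⁺ n))

  pairs-mono : {S : Rel (Fin n) 0ℓ} (S? : Decidable S) → (∀ {u v} → R u v → S u v) →
               pairs R? ⊆ pairs S?
  pairs-mono S? R⊆S = Sublistₚ.filter⁺ (pair? R?) (pair? S?)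
    (λ { refl (u<v , uv) → u<v , R⊆S uv })
    (⊆-refl {x = cartesianProduct (allFin n) (allFin n)})

  length-pairs-mono : {S : Rel (Fin n) 0ℓ} (S? : Decidable S) → (∀ {u v} → R u v → S u v) →
                      length (pairs R?) ≤ length (pairs S?)
  length-pairs-mono S? R⊆S = Sublistₚ.length-mono-≤ (pairs-mono S? R⊆S)

module _ {R : Rel (Fin (suc n)) 0ℓ} (R? : Decidable R) where
  private
    R?′ : Decidable (λ u v → R (suc u) (suc v))
    R?′ u v = R? (suc u) (suc v)

    shifted : List (Fin (suc n))
    shifted = map suc (allFin n)

  length-filter-row : ∀ u → length (filter (pair? R?) (map (u ,_) shifted)) ≡
                            count (λ v → pair? R? (u , suc v))
  length-filter-row u = trans (length-filter-map (pair? R?) (u ,_) shifted)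
                              (length-filter-map (pair? R? ∘ (u ,_)) suc (allFin n))

  -- Pairs are sorted by whether the smaller vertex is `zero`; those where it is not live on the
  -- other `n` vertices. The inductions on pair counts below rest on this recursion.
  length-pairs-suc : length (pairs R?) ≡ count (R? zero ∘ suc) + length (pairs R?′)
  length-pairs-suc = begin
    length (pairs R?)
      ≡⟨ cong (λ xs → length (filter (pair? R?) (cartesianProduct xs xs))) (allFin-suc n) ⟩
    -- The pair `(zero , zero)` has dropped out: `filter` rejects it by computation, nothing being
    -- below `zero`.
    length (filter (pair? R?) (map (zero ,_) shifted ++ rows (allFin n)))
      ≡⟨ length-filter-++ (pair? R?) (map (zero ,_) shifted) _ ⟩
    length (filter (pair? R?) (map (zero ,_) shifted)) + length (filter (pair? R?) (rows (allFin n)))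
      ≡⟨ cong₂ _+_ row₀ (length-filter-rows (allFin n)) ⟩
    count (R? zero ∘ suc) + length (pairs R?′) ∎
    where
    open ≡-Reasoning
    rows : List (Fin n) → List (Pair (suc n))
    rows us = cartesianProduct (map suc us) (zero ∷ shifted)
    row₀ : length (filter (pair? R?) (map (zero ,_) shifted)) ≡ count (R? zero ∘ suc)
    row₀ = trans (length-filter-row zero)
                 (cong length (filter-≐ _ (R? zero ∘ suc) (proj₂ , (s≤s z≤n ,_)) (allFin n)))
    row₊ : ∀ u → length (filter (pair? R?) (map (suc u ,_) shifted)) ≡
                 length (filter (pair? R?′) (map (u ,_) (allFin n)))
    row₊ u = begin
      length (filter (pair? R?) (map (suc u ,_) shifted))
        ≡⟨ length-filter-row (suc u) ⟩
      count (λ v → pair? R? (suc u , suc v))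
        ≡⟨ cong length (filter-≐ (λ v → pair? R? (suc u , suc v)) (λ v → pair? R?′ (u , v))
             ((λ { (s≤s u<v , uv) → u<v , uv }) , (λ { (u<v , uv) → s≤s u<v , uv })) (allFin n)) ⟩
      count (λ v → pair? R?′ (u , v))
        ≡⟨ length-filter-map (pair? R?′) (u ,_) (allFin n) ⟨
      length (filter (pair? R?′) (map (u ,_) (allFin n))) ∎
    length-filter-rows : ∀ us → length (filter (pair? R?) (rows us)) ≡
                                length (filter (pair? R?′) (cartesianProduct us (allFin n)))
    length-filter-rows []       = refl
    length-filter-rows (u ∷ us) = begin
      length (filter (pair? R?) (map (suc u ,_) shifted ++ rows us))
        ≡⟨ length-filter-++ (pair? R?) (map (suc u ,_) shifted) _ ⟩
      length (filter (pair? R?) (map (suc u ,_) shifted)) + length (filter (pair? R?) (rows us))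
        ≡⟨ cong₂ _+_ (row₊ u) (length-filter-rows us) ⟩
      length (filter (pair? R?′) (map (u ,_) (allFin n))) +
      length (filter (pair? R?′) (cartesianProduct us (allFin n)))
        ≡⟨ length-filter-++ (pair? R?′) (map (u ,_) (allFin n)) _ ⟨
      length (filter (pair? R?′) (cartesianProduct (u ∷ us) (allFin n))) ∎

[1+n]C2≡n+nC2 : ∀ n → suc n C 2 ≡ n + n C 2
[1+n]C2≡n+nC2 n = trans (sym (nCk+nC[k+1]≡[n+1]C[k+1] n 1)) (cong (_+ n C 2) (nC1≡n n))

-- Vertex `zero` lies in `n` pairs, whichever side they fall on, so the induction is Pascal's rule.
length-pairs-¬ : {R : Rel (Fin n) 0ℓ} (R? : Decidable R) →
  length (pairs R?) + length (pairs (λ u v → ¬? (R? u v))) ≡ n C 2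
length-pairs-¬ {zero}  R? = refl
length-pairs-¬ {suc n} R? = begin
  length (pairs R?) + length (pairs (λ u v → ¬? (R? u v)))
    ≡⟨ cong₂ _+_ (length-pairs-suc R?) (length-pairs-suc (λ u v → ¬? (R? u v))) ⟩
  (c + p) + (c′ + p′)   ≡⟨ interchange c p c′ p′ ⟩
  (c + c′) + (p + p′)   ≡⟨ cong₂ _+_
    (trans (length-filter-¬ (R? zero ∘ suc) (allFin n)) (length-tabulate id))
    (length-pairs-¬ (λ u v → R? (suc u) (suc v))) ⟩
  n + n C 2             ≡⟨ [1+n]C2≡n+nC2 n ⟨
  suc n C 2             ∎
  where
  open ≡-Reasoning
  open import Algebra.Properties.CommutativeSemigroup ℕₚ.+-commutativeSemigroup using (interchange)
  c  = count (R? zero ∘ suc)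
  c′ = count (¬? ∘ R? zero ∘ suc)
  p  = length (pairs (λ u v → R? (suc u) (suc v)))
  p′ = length (pairs (λ u v → ¬? (R? (suc u) (suc v))))

-- Labellings

same? : (c : Fin n → Fin m) → Decidable (λ u v → c u ≡ c v)
same? c u v = c u ≟ c v

cross? : (c : Fin n → Fin m) → Decidable (λ u v → c u ≢ c v)
cross? c u v = ¬? (c u ≟ c v)

length-cross : (c : Fin n → Fin m) → length (pairs (cross? c)) ≡ n C 2 ∸ length (pairs (same? c))
length-cross c = trans (sym (ℕₚ.m+n∸m≡n (length (pairs (same? c))) _))
                       (cong (_∸ length (pairs (same? c))) (length-pairs-¬ (same? c)))

onto⇒≥ : {f : Fin n → Fin m} → Onto f → m ≤ n
onto⇒≥ {f = f} onto = injective⇒≤ {f = proj₁ ∘ onto} λ {y} {z} eq →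
  trans (sym (proj₂ (onto y))) (trans (cong f eq) (proj₂ (onto z)))

-- The vertex `suc w` carries the label of `zero`, so dropping `zero` loses no label.
onto-tail : {c : Fin (suc n) → Fin m} → Onto c → ∀ {w} → c (suc w) ≡ c zero → Onto (c ∘ suc)
onto-tail onto {w} hit y with onto y
... | zero  , e = w , trans hit e
... | suc u , e = u , e

-- Bounding class sizes along with pairs lets one induction on n prove both.
onto⇒same≤ : ∀ q (c : Fin n → Fin m) → Onto c → m + q ≡ n →
  (∀ y → count (λ v → c v ≟ y) ≤ suc q) × length (pairs (same? c)) ≤ suc q C 2
onto⇒same≤ {zero}  q c onto eq = (λ y → z≤n) , z≤n
-- If a later vertex shares the class of `zero`, dropping `zero` keeps all labels and lowers `q` by
-- one. Otherwise `zero` is a singleton class, and dropping it removes its label and keeps `q`.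
onto⇒same≤ {suc n} {m} q c onto eq with any? (λ w → c (suc w) ≟ c zero)
onto⇒same≤ {suc n} {m} zero c onto eq | yes (w , hit) =
  -- With no slack, the remaining `n` vertices would have to map onto `suc n` labels.
  contradiction (subst (_≤ n) (trans (sym (ℕₚ.+-identityʳ m)) eq) (onto⇒≥ (onto-tail onto hit))) ℕₚ.1+n≰n
onto⇒same≤ {suc n} {m} (suc q) c onto eq | yes (w , hit) = classes , same≤
  where
  ih = onto⇒same≤ q (c ∘ suc) (onto-tail onto hit) (ℕₚ.suc-injective (trans (sym (ℕₚ.+-suc m q)) eq))
  classes : ∀ y → count (λ v → c v ≟ y) ≤ suc (suc q)
  classes y = by-head (c zero ≟ y)
    where
    by-head : Dec (c zero ≡ y) → count (λ v → c v ≟ y) ≤ suc (suc q)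
    by-head (yes p) = ℕₚ.≤-trans (ℕₚ.≤-reflexive (count-accept (λ v → c v ≟ y) p)) (s≤s (proj₁ ih y))
    by-head (no ¬p) = ℕₚ.≤-trans (ℕₚ.≤-reflexive (count-reject (λ v → c v ≟ y) ¬p)) (ℕₚ.m≤n⇒m≤1+n (proj₁ ih y))
  same≤ : length (pairs (same? c)) ≤ suc (suc q) C 2
  same≤ = begin
    length (pairs (same? c))
      ≡⟨ length-pairs-suc (same? c) ⟩
    count (λ v → c zero ≟ c (suc v)) + length (pairs (same? (c ∘ suc)))
      -- Vertex `zero` is paired with the rest of its class, at most `suc q` vertices by the class
      -- bound; Pascal's rule then closes the sum.
      ≤⟨ ℕₚ.+-mono-≤ (ℕₚ.≤-trans (count-mono _ (λ v → c (suc v) ≟ c zero) sym) (proj₁ ih (c zero)))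
                     (proj₂ ih) ⟩
    suc q + suc q C 2
      ≡⟨ [1+n]C2≡n+nC2 (suc q) ⟨
    suc (suc q) C 2 ∎
    where open ℕₚ.≤-Reasoning
onto⇒same≤ {suc n} {zero}  q c onto eq | no ¬hit with () ← c zero
onto⇒same≤ {suc n} {suc m} q c onto eq | no ¬hit = classes , same≤
  where
  c₀≢ : ∀ w → c zero ≢ c (suc w)
  c₀≢ w e = ¬hit (w , sym e)
  c′ : Fin n → Fin m
  c′ w = punchOut (c₀≢ w)
  onto′ : Onto c′
  onto′ y with onto (punchIn (c zero) y)
  ... | zero  , e = contradiction (sym e) (Finₚ.punchInᵢ≢i (c zero) y)
  ... | suc u , e = u , trans (Finₚ.punchOut-cong (c zero) e) (Finₚ.punchOut-punchIn (c zero))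
  ih = onto⇒same≤ q c′ onto′ (ℕₚ.suc-injective eq)
  count≡0 : {P : Fin n → Set} (P? : U.Decidable P) → (∀ v → ¬ P v) → count P? ≡ 0
  count≡0 P? ¬p = cong length (filter-none P? (All.universal ¬p (allFin n)))
  classes : ∀ y → count (λ v → c v ≟ y) ≤ suc q
  classes y = by-head (c zero ≟ y)
    where
    by-head : Dec (c zero ≡ y) → count (λ v → c v ≟ y) ≤ suc q
    by-head (yes p) = ℕₚ.≤-trans (ℕₚ.≤-reflexive (trans (count-accept (λ v → c v ≟ y) p)
                  (cong suc (count≡0 (λ v → c (suc v) ≟ y) (λ v e → c₀≢ v (trans p (sym e)))))))
                  (s≤s z≤n)
    by-head (no ¬p) = ℕₚ.≤-trans (ℕₚ.≤-reflexive (count-reject (λ v → c v ≟ y) ¬p))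
               (ℕₚ.≤-trans (count-mono _ (λ v → c′ v ≟ punchOut ¬p) (Finₚ.punchOut-cong (c zero)))
                           (proj₁ ih (punchOut ¬p)))
  same≤ : length (pairs (same? c)) ≤ suc q C 2
  same≤ = begin
    length (pairs (same? c))
      ≡⟨ length-pairs-suc (same? c) ⟩
    count (λ v → c zero ≟ c (suc v)) + length (pairs (same? (c ∘ suc)))
      ≡⟨ cong (_+ length (pairs (same? (c ∘ suc)))) (count≡0 (λ v → c zero ≟ c (suc v)) c₀≢) ⟩
    length (pairs (same? (c ∘ suc)))
      ≤⟨ length-pairs-mono (same? (c ∘ suc)) (same? c′) (Finₚ.punchOut-cong (c zero)) ⟩
    length (pairs (same? c′))
      ≤⟨ proj₂ ih ⟩
    suc q C 2 ∎
    where open ℕₚ.≤-Reasoning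

-- Used with n = k + q, so that the class of big is all but k ∸ 1 of the vertices.
record Concentrated (n k q : ℕ) : Set where
  field
    label : Fin n → Fin k
    onto  : Onto label
    big   : Fin k
    big≥  : suc q ≤ count (λ v → label v ≟ big)
    same≥ : suc q C 2 ≤ length (pairs (same? label))

open Concentrated

isolate : Concentrated n k q → Concentrated (suc n) (suc k) q
isolate {n} {k} {q} P = record
  { label = c ; onto = onto′ ; big = suc (big P)
  ; big≥  = begin
      suc q                                  ≤⟨ big≥ P ⟩
      count (λ v → label P v ≟ big P)        ≤⟨ count-mono _ (λ v → c (suc v) ≟ suc (big P)) (cong suc) ⟩
      count (λ v → c (suc v) ≟ suc (big P))  ≡⟨ count-reject (λ v → c v ≟ suc (big P)) (λ ()) ⟨
      count (λ v → c v ≟ suc (big P))        ∎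
  ; same≥ = begin
      suc q C 2                          ≤⟨ same≥ P ⟩
      length (pairs (same? (label P)))   ≤⟨ length-pairs-mono (same? (label P)) (same? (c ∘ suc)) (cong suc) ⟩
      length (pairs (same? (c ∘ suc)))   ≤⟨ ℕₚ.m≤n+m _ _ ⟩
      count (λ v → c zero ≟ c (suc v)) + length (pairs (same? (c ∘ suc)))
        ≡⟨ length-pairs-suc (same? c) ⟨
      length (pairs (same? c))           ∎
  }
  where
  open ℕₚ.≤-Reasoning
  c : Fin (suc n) → Fin (suc k)
  c zero    = zero
  c (suc v) = suc (label P v)
  onto′ : Onto c
  onto′ zero    = zero , refl
  onto′ (suc y) = let (u , e) = onto P y in suc u , cong suc e

-- Joining the class `big` creates at least `suc q` new pairs inside it, the increment in Pascal's
-- rule; this is why `big≥` is carried along.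
absorb : Concentrated n k q → Concentrated (suc n) k (suc q)
absorb {n} {k} {q} P = record
  { label = c ; onto = λ y → let (u , e) = onto P y in suc u , e ; big = big P
  ; big≥  = ℕₚ.≤-trans (s≤s (big≥ P)) (ℕₚ.≤-reflexive (sym (count-accept (λ v → c v ≟ big P) refl)))
  ; same≥ = begin
      suc (suc q) C 2                    ≡⟨ [1+n]C2≡n+nC2 (suc q) ⟩
      suc q + suc q C 2
        ≤⟨ ℕₚ.+-mono-≤ (ℕₚ.≤-trans (big≥ P) (count-mono _ (λ v → c zero ≟ c (suc v)) sym)) (same≥ P) ⟩
      count (λ v → c zero ≟ c (suc v)) + length (pairs (same? (c ∘ suc)))
        ≡⟨ length-pairs-suc (same? c) ⟨
      length (pairs (same? c))           ∎
  }
  where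
  open ℕₚ.≤-Reasoning
  c : Fin (suc n) → Fin k
  c zero    = big P
  c (suc v) = label P v

concentrated : ∀ k q → Concentrated (suc k + q) (suc k) q
concentrated zero    zero    = record
  { label = id ; onto = λ y → y , refl ; big = zero ; big≥ = s≤s z≤n ; same≥ = z≤n }
concentrated zero    (suc q) = absorb (concentrated zero q)
concentrated (suc k) q       = isolate (concentrated k q)

-- If `u` or `v` is the first vertex, that vertex is isolated. Otherwise the first vertex is
-- isolated while `k` lasts, then absorbed while `q` lasts, and the recursion separates the
-- predecessors of `u` and `v`. Once only two vertices are left, distinct `u` and `v` cannot both
-- avoid the first.
separating : ∀ k q (u v : Fin (2 + k + q)) → u ≢ v →
             Σ (Concentrated (2 + k + q) (2 + k) q) λ P → label P u ≢ label P v
separating k q zero    zero    u≢v = contradiction refl u≢v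
separating k q zero    (suc v) u≢v = isolate (concentrated k q) , λ ()
separating k q (suc u) zero    u≢v = isolate (concentrated k q) , λ ()
separating (suc k) q (suc u) (suc v) u≢v =
  let (P , sep) = separating k q u v (u≢v ∘ cong suc) in isolate P , sep ∘ Finₚ.suc-injective
separating zero (suc q) (suc u) (suc v) u≢v =
  let (P , sep) = separating zero q u v (u≢v ∘ cong suc) in absorb P , sep
separating zero zero (suc zero) (suc zero) u≢v = contradiction refl u≢v

-- Removing the edges between classes

crossing : Graph n → (Fin n → Fin m) → Graph n
crossing G c .Adj u v        = Adj G u v × c u ≢ c v
crossing G c .adj? u v       = adj? G u v ×-dec cross? c u v
crossing G c .symm (uv , ne) = symm G uv , ne ∘ sym
crossing G c .irrefl eq      = irrefl G eq ∘ proj₁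

─-crossing : ∀ (G : Graph n) (c : Fin n → Fin m) {u v} →
             Adj (G ─ edges (crossing G c)) u v → c u ≡ c v
─-crossing G c {u} {v} (uv , uv∉ , vu∉) = decidable-stable (c u ≟ c v) λ ne → contra ne
  where
  contra : ¬ c u ≢ c v
  contra ne with Finₚ.<-cmp u v
  ... | tri< u<v _ _ = uv∉ (∈-edges (crossing G c) u<v (uv , ne))
  ... | tri≈ _ u≡v _ = irrefl G u≡v uv
  ... | tri> _ _ v<u = vu∉ (∈-edges (crossing G c) v<u (symm G uv , ne ∘ sym))

-- After the removal `c` is constant along the remaining edges, so its `k` labels force as many
-- components. The general upper bound comes from such a cut.
crossing-separates : ∀ (G : Graph n) (c : Fin n → Fin k) → Onto c →
                     Separates G k (length (edges (crossing G c)))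
crossing-separates G c onto =
  edges (crossing G c) , pairs-mono (adj? (crossing G c)) (adj? G) proj₁ , refl ,
  onto⇒≤#components (G ─ edges (crossing G c)) c onto (─-crossing G c)

edges-crossing⊆ : ∀ (G : Graph n) (c : Fin n → Fin m) → edges (crossing G c) ⊆ pairs (cross? c)
edges-crossing⊆ G c = pairs-mono (adj? (crossing G c)) (cross? c) proj₂

length-cross≤ : (P : Concentrated n k q) → length (pairs (cross? (label P))) ≤ n C 2 ∸ suc q C 2
length-cross≤ {n} P =
  ℕₚ.≤-trans (ℕₚ.≤-reflexive (length-cross (label P))) (ℕₚ.∸-monoʳ-≤ (n C 2) (same≥ P))

C2-mono : ∀ {m n} → m ≤ n → m C 2 ≤ n C 2
C2-mono {n = n} z≤n = z≤n
C2-mono {suc m} {suc n} (s≤s m≤n) = begin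
  suc m C 2   ≡⟨ [1+n]C2≡n+nC2 m ⟩
  m + m C 2   ≤⟨ ℕₚ.+-mono-≤ m≤n (C2-mono m≤n) ⟩
  n + n C 2   ≡⟨ [1+n]C2≡n+nC2 n ⟨
  suc n C 2   ∎
  where open ℕₚ.≤-Reasoning

-- Complete graphs and full crossings

module _ (G : Graph n) (complete : ∀ {u v} → u ≢ v → Adj G u v) where

  -- Vertices in different components of `G ─ F` were adjacent in the complete graph, so their edge
  -- must be in `F`.
  cross≤removed : ∀ {F} → F ⊆ edges G → length (pairs (cross? (component (G ─ F)))) ≤ length F
  cross≤removed {F} F⊆ = unique-⊆⇒length≤ (pairs-unique (cross? c)) removed
    where
    c = component (G ─ F)
    removed : ∀ {p} → p ∈ pairs (cross? c) → p ∈ F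
    removed {u , v} p∈ with ∈-pairs⁻ (cross? c) p∈
    ... | u<v , cu≢cv = decidable-stable (_∈?_ _≟ₚ_ (u , v) F) λ uv∉F →
      cu≢cv (component-cong (G ─ F) (return (complete (cu≢cv ∘ cong c) , uv∉F ,
        -- The reversed pair cannot be in `F`, since `edges` lists the smaller endpoint first.
        λ vu∈F → ℕₚ.<-asym u<v (proj₁ (∈-pairs⁻ (adj? G) (Sublistₚ.Any-resp-⊆ F⊆ vu∈F))))))

  -- The components of `G ─ F` are the classes of an onto labelling, so the pairs inside them are
  -- few, and `F` contains all the others.
  complete-separates⇒≥ : ∀ {l} → k + q ≡ n → Separates G k l → n C 2 ∸ suc q C 2 ≤ l
  complete-separates⇒≥ {k} {q} k+q≡n (F , F⊆ , refl , k≤m) = begin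
    n C 2 ∸ suc q C 2                    ≤⟨ ℕₚ.∸-monoʳ-≤ (n C 2) same≤ ⟩
    n C 2 ∸ length (pairs (same? c))     ≡⟨ length-cross c ⟨
    length (pairs (cross? c))            ≤⟨ cross≤removed F⊆ ⟩
    length F                             ∎
    where
    open ℕₚ.≤-Reasoning
    d = #components (G ─ F)
    c = component (G ─ F)
    c-onto = component-onto (G ─ F)
    -- There may be more than `k` components; the slack `n ∸ d` is then smaller, and `C2-mono`
    -- passes back to `q`.
    n∸d≤q : n ∸ d ≤ q
    n∸d≤q = ℕₚ.m≤n+o⇒m∸n≤o n d (subst (_≤ d + q) k+q≡n (ℕₚ.+-monoˡ-≤ q k≤m))
    same≤ : length (pairs (same? c)) ≤ suc q C 2
    same≤ = ℕₚ.≤-trans (proj₂ (onto⇒same≤ (n ∸ d) c c-onto (ℕₚ.m+[n∸m]≡n (onto⇒≥ c-onto))))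
                       (C2-mono (s≤s n∸d≤q))

-- A sublist of full length is the whole list, so every pair that `c` separates is an edge.
crossing-full⇒adj : ∀ (G : Graph n) (c : Fin n → Fin m) →
  length (pairs (cross? c)) ≤ length (edges (crossing G c)) → ∀ {u v} → c u ≢ c v → Adj G u v
crossing-full⇒adj G c full {u} {v} cu≢cv = by-order (Finₚ.<-cmp u v)
  where
  edges≡ : edges (crossing G c) ≡ pairs (cross? c)
  edges≡ = Pointwise-≡⇒≡ (toPointwise
    (ℕₚ.≤-antisym (Sublistₚ.length-mono-≤ (edges-crossing⊆ G c)) full) (edges-crossing⊆ G c))
  adj : ∀ {u v} → u Fin.< v → c u ≢ c v → Adj G u v
  adj u<v ne = proj₁ (proj₂ (∈-pairs⁻ (adj? (crossing G c))
    (subst (_ ∈_) (sym edges≡) (∈-pairs⁺ (cross? c) u<v ne))))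
  by-order : Tri (u Fin.< v) (u ≡ v) (v Fin.< u) → Adj G u v
  by-order (tri< u<v _ _) = adj u<v cu≢cv
  by-order (tri≈ _ u≡v _) = contradiction (cong c u≡v) cu≢cv
  by-order (tri> _ _ v<u) = symm G (adj v<u (cu≢cv ∘ sym))

≅K⇒complete : (G : Graph n) → G ≅ K n → ∀ {u v} → u ≢ v → Adj G u v
≅K⇒complete G (π , iso) {u} {v} u≢v = Equivalence.from (iso u v) (u≢v ∘ Injection.injective (↔⇒↣ π))

complete⇒≅K : (G : Graph n) → (∀ {u v} → u ≢ v → Adj G u v) → G ≅ K n
complete⇒≅K G complete = idₚ , λ u v → mk⇔ (λ uv u≡v → irrefl G u≡v uv) complete

-- Bounds and equality cases

module _ (G : Graph n) {k} (k≤n : k ≤ n) where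
  private spec = proj₂ (edgeConnectivity-exists G k k≤n)

  edgeConnectivity-separates : Separates G k (edgeConnectivity G k k≤n)
  edgeConnectivity-separates = proj₁ spec

  edgeConnectivity≤ : ∀ {l} → Separates G k l → edgeConnectivity G k k≤n ≤ l
  edgeConnectivity≤ = proj₂ spec

module _ (G : Graph n) (conn : Connected G) where

  -- A connected graph starts with at most one component and each deletion adds at most one.
  separates⇒≤ : ∀ {l} → Separates G (suc k) l → k ≤ l
  separates⇒≤ {k} (F , _ , refl , k<m) = ℕₚ.≤-pred (begin
    suc k                       ≤⟨ k<m ⟩
    #components (G ─ F)         ≤⟨ #components-─ G F ⟩
    length F + #components G    ≤⟨ ℕₚ.+-monoʳ-≤ (length F) (connected⇒#components≤1 G conn) ⟩
    length F + 1                ≡⟨ ℕₚ.+-comm (length F) 1 ⟩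
    suc (length F)              ∎)
    where open ℕₚ.≤-Reasoning

  -- No deletion is wasted: if some `e` in `F` were not a cut edge, the other `k ∸ 1` deletions
  -- could not reach `suc k` components.
  separates⇒≤#cutEdges : Separates G (suc k) k → k ≤ #cutEdges G
  separates⇒≤#cutEdges (F , F⊆ , refl , k<m) = subst (_≤ #cutEdges G)
    -- Filtering leaves `F` unchanged, as all its edges are cut edges, and the filtered `F` is a
    -- sublist of the cut edges of `G`.
    (cong length (filter-all (isCutEdge? G) (All.tabulate cut)))
    (Sublistₚ.length-mono-≤ (Sublistₚ.filter⁺ (isCutEdge? G) (isCutEdge? G) (λ { refl → id }) F⊆))
    where
    open ℕₚ.≤-Reasoning
    cut : ∀ {e} → e ∈ F → IsCutEdge G e
    cut {e} e∈F = ℕₚ.≤-trans (s≤s (connected⇒#components≤1 G conn))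
      (ℕₚ.+-cancelˡ-≤ (length F) _ _ (begin
      length F + 2                          ≡⟨ ℕₚ.+-comm (length F) 2 ⟩
      2 + length F                          ≤⟨ s≤s k<m ⟩
      suc (#components (G ─ F))             ≤⟨ #components-─-∈ G e∈F ⟩
      length F + #components (G ─ [ e ])    ∎))

-- Any `k` cut edges will do, since each deletion gains a component; having a vertex, `G` starts
-- with at least one.
≤#cutEdges⇒separates : (G : Graph (suc n)) → k ≤ #cutEdges G → Separates G (suc k) k
≤#cutEdges⇒separates {k = k} G k≤ = F , F⊆ , |F|≡k , (begin
  suc k                       ≡⟨ ℕₚ.+-comm k 1 ⟨
  k + 1                       ≡⟨ cong (_+ 1) |F|≡k ⟨
  length F + 1                ≤⟨ ℕₚ.+-monoʳ-≤ (length F) 1≤#components ⟩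
  length F + #components G    ≤⟨ #components-─-cutEdges G unique edge cut ⟩
  #components (G ─ F)         ∎)
  where
  open ℕₚ.≤-Reasoning
  1≤#components : 1 ≤ #components G
  1≤#components = ℕₚ.≤-trans (s≤s z≤n) (Finₚ.toℕ<n (component G zero))
  F = take k (filter (isCutEdge? G) (edges G))
  F⊆cuts : F ⊆ filter (isCutEdge? G) (edges G)
  F⊆cuts = Sublistₚ.take-⊆ k _
  F⊆ : F ⊆ edges G
  F⊆ = ⊆-trans F⊆cuts (Sublistₚ.filter-⊆ (isCutEdge? G) (edges G))
  |F|≡k : length F ≡ k
  |F|≡k = trans (length-take k _) (ℕₚ.m≤n⇒m⊓n≡m k≤)
  unique : Unique F
  unique = Uniqueₚ.take⁺ k (Uniqueₚ.filter⁺ (isCutEdge? G) (pairs-unique (adj? G)))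
  edge : All (λ (u , v) → u Fin.< v × Adj G u v) F
  edge = All.tabulate (∈-pairs⁻ (adj? G) ∘ Sublistₚ.Any-resp-⊆ F⊆)
  cut : All (IsCutEdge G) F
  cut = Sublistₚ.All-resp-⊆ F⊆cuts (Allₚ.all-filter (isCutEdge? G) (edges G))

theorem3p2 : ∀ {n} (G : Graph n) → Connected G →
    ∀ k → 2 ≤ k → (k≤n : k ≤ n) →
    let λₖ    = edgeConnectivity G k k≤n
        upper = (n C 2) ∸ ((n ∸ k + 1) C 2)
    in (k ∸ 1 ≤ λₖ × λₖ ≤ upper)
     × (λₖ ≡ k ∸ 1 ⇔ k ∸ 1 ≤ #cutEdges G)
     × (λₖ ≡ upper ⇔ G ≅ K n)
theorem3p2 {n} G conn (suc (suc k)) (s≤s (s≤s z≤n)) k≤n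
  -- Writing the order as `2 + k + q` turns the upper argument `n ∸ (2 + k) + 1` into `suc q`.
  with q , refl ← ℕₚ.m≤n⇒∃[o]m+o≡n k≤n
  rewrite ℕₚ.m+n∸m≡n (2 + k) q | ℕₚ.+-comm q 1 =
  (lower≤ , λ≤upper) ,
  mk⇔ (λ eq → separates⇒≤#cutEdges G conn (subst (Separates G (2 + k)) eq separates))
      (λ cuts → ℕₚ.≤-antisym (edgeConnectivity≤ G k≤n (≤#cutEdges⇒separates G cuts)) lower≤) ,
  mk⇔ (λ eq → complete⇒≅K G (λ {u} {v} → complete eq))
      (λ iso → ℕₚ.≤-antisym (λ≤upper)
                 (complete-separates⇒≥ G (≅K⇒complete G iso) refl separates))
  where
  λₖ = edgeConnectivity G (2 + k) k≤n
  separates = edgeConnectivity-separates G k≤n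
  lower≤ = separates⇒≤ G conn separates
  upper = (2 + k + q) C 2 ∸ suc q C 2
  λ≤ : (P : Concentrated (2 + k + q) (2 + k) q) → λₖ ≤ length (edges (crossing G (label P)))
  λ≤ P = edgeConnectivity≤ G k≤n (crossing-separates G (label P) (onto P))
  λ≤upper : λₖ ≤ upper
  λ≤upper = let P = concentrated (suc k) q in
    ℕₚ.≤-trans (λ≤ P)
      (ℕₚ.≤-trans (Sublistₚ.length-mono-≤ (edges-crossing⊆ G (label P))) (length-cross≤ P))
  -- The cut chosen to separate `u` from `v` has at most `upper` crossing pairs, while `λₖ ≡ upper`
  -- demands at least `upper` crossing edges; so all its crossing pairs, `u` and `v` among them, are
  -- edges.
  complete : λₖ ≡ upper → ∀ {u v} → u ≢ v → Adj G u v
  complete eq {u} {v} u≢v = let (P , sep) = separating k q u v u≢v in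
    crossing-full⇒adj G (label P)
      (ℕₚ.≤-trans (length-cross≤ P) (ℕₚ.≤-trans (ℕₚ.≤-reflexive (sym eq)) (λ≤ P))) sep
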